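{- For all integers $k\geq 2$ and $n\geq 2$, $$f(n,k)\geq \frac{(n+k)(n+k+1)\cdots(n+2k-1)}{2^{k-1}k^k}.$$
   Context: All graphs are finite, simple and undirected. For integers $n,k>1$, $f(n,k)$ denotes the maximal integer $f$ with the following property: if a graph $G=(V,E)$ contains no odd cycles of length at most $2k-1$ and $|V|\leq f$, then $G$ has a proper vertex coloring in $n$ colors. -}

module Defs where

open import Data.Fin using (Fin; zero; suc; inject₁; fromℕ)
open import Data.Integer using (+_)
open import Data.List.Base using (applyUpTo)
open import Data.Nat.ListAction using (product)
open import Data.Nat using (ℕ; zero; suc; _+_; _*_; _∸_; _^_; _≤_; NonZero)
open import Data.Nat.Divisibility using (_∣_)
open import Data.Nat.Properties using (m*n≢0; m^n≢0)
open import Data.Product using (_×_; Σ-syntax)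
open import Data.Rational.Unnormalised as ℚᵘ using (ℚᵘ)
open import Function.Definitions using (Injective)
open import Level as Level using (Level; 0ℓ)
open import Relation.Binary using (Rel; Symmetric; Decidable)
open import Relation.Binary.PropositionalEquality using (_≡_; _≢_)
open import Relation.Nullary using (¬_)
open import Relation.Unary using (Pred)

-- Decidability of adjacency is automatic classically; constructively it is
-- part of what it means for the edge set to be finite.
record Graph : Set₁ where
  field
    order  : ℕ
    Adj    : Rel (Fin order) 0ℓ
    symm   : Symmetric Adj
    irrefl : ∀ v → ¬ Adj v v
    adj?   : Decidable Adj

  Vertex : Set
  Vertex = Fin order

-- A cycle v₀ v₁ … vₘ of length m + 1 ≥ 3, with distinct vertices.
record Cycle (G : Graph) : Set where
  open Graph G
  field
    m         : ℕ
    3≤length  : 3 ≤ suc m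
    vertex    : Fin (suc m) → Vertex
    distinct  : Injective _≡_ _≡_ vertex
    step      : ∀ (i : Fin m) → Adj (vertex (inject₁ i)) (vertex (suc i))
    close     : Adj (vertex (fromℕ m)) (vertex zero)

  length : ℕ
  length = suc m

Odd : ℕ → Set
Odd l = ¬ (2 ∣ l)

NoOddCycleUpTo : ℕ → Graph → Set
NoOddCycleUpTo l G = ∀ (C : Cycle G) → Odd (Cycle.length C) → ¬ (Cycle.length C ≤ l)

Colourable : ℕ → Graph → Set
Colourable n G =
  Σ[ colour ∈ (Vertex → Fin n) ] (∀ {u v} → Adj u v → colour u ≢ colour v)
  where open Graph G

ColourableUpTo : (n k f : ℕ) → Set₁
ColourableUpTo n k f =
  ∀ (G : Graph) → NoOddCycleUpTo (2 * k ∸ 1) G → Graph.order G ≤ f → Colourable n G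

IsMaximum : ∀ {ℓ : Level} → Pred ℕ ℓ → Pred ℕ ℓ
IsMaximum P f = P f × (∀ g → P g → g ≤ f)

-- The relation "f = f(n,k)"; such an f is unique.
Is-f⟨_,_⟩ : (n k : ℕ) → Pred ℕ (Level.suc 0ℓ)
Is-f⟨ n , k ⟩ = IsMaximum (ColourableUpTo n k)

denominator : ℕ → ℕ
denominator k = 2 ^ (k ∸ 1) * k ^ k

-- Also holds at k = 0, where the empty power 0 ^ 0 is 1.
denominator≢0 : ∀ k → NonZero (denominator k)
denominator≢0 zero    = _
denominator≢0 (suc k) =
  m*n≢0 (2 ^ k) (suc k ^ suc k) {{m^n≢0 2 k}} {{m^n≢0 (suc k) (suc k)}}

-- The numerator is the product of n + k + i over 0 ≤ i < k.
bound : (n k : ℕ) → ℚᵘ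
bound n k = (+ product (applyUpTo (λ i → n + k + i) k)) ℚᵘ./ denominator k
  where instance _ = denominator≢0 k

fromℕ-ℚᵘ : ℕ → ℚᵘ
fromℕ-ℚᵘ n = (+ n) ℚᵘ./ 1

{-# OPTIONS --safe #-}
module Submission where

-- Let B n be the bound.  By induction on n, every vertex set S with |S| < B n + 1 is n-colourable:
-- one colour class is an independent I ⊆ S for which S ─ I satisfies |S ─ I| < B (n - 1) + 1.
-- To find I, put ρ = (n + k - 1) / k and grow layers A₀ = {v}, Aᵢ₊₁ = N(Aᵢ) ∩ S.  For i < k the
-- layer Aᵢ is independent, since an edge inside it closes a walk of odd length at most 2k - 1.
-- If the layers always grow by a factor exceeding ρ, then |Aₖ₋₁| ≥ ρ^(k-1) ≥ B n - B (n - 1) and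
-- I = Aₖ₋₁ will do.  Otherwise |Aᵢ₊₁| ≤ ρ |Aᵢ| for some i; put Aᵢ into I, delete Aᵢ ∪ Aᵢ₊₁ from S
-- and start again.  If this exhausts S then |I| ≥ |S| / (1 + ρ), which suffices because
-- B n / B (n - 1) = (1 + ρ) / ρ.  For n = 2 one has B 2 ≤ 3, so |S| ≤ 3 and S spans no triangle.

open import Data.Bool.Base using (true; false)
open import Data.Fin.Base as Fin using (Fin; zero; suc; toℕ)
open import Data.Fin.Properties as Fin using (any?; toℕ-inject₁; toℕ-fromℕ; toℕ<n)
open import Data.Fin.Subset using (Subset; _∈_; _∉_; _⊆_; _∪_; _∩_; _─_; ⁅_⁆; ⊤; ∣_∣; Empty)
open import Data.Fin.Subset.Properties
open import Data.Integer.Base as ℤ using (+_; +≤+)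
import Data.Integer.Properties as ℤ
open import Data.List.Base using (applyUpTo; [_])
open import Data.List.Properties using (applyUpTo-∷ʳ)
open import Data.Nat using (ℕ; zero; suc; _+_; _*_; _∸_; _^_; _≤_; _<_; z≤n; s≤s; z<s; NonZero; >-nonZero; _≤?_; _<?_)
open import Data.Nat.Divisibility using (_∣_; _∣?_; divides; ∣m∣n⇒∣m+n; ∣m+n∣m⇒∣n; m∣m*n; ∣1⇒≡1)
open import Data.Nat.Induction using (<-wellFounded)
open import Data.Nat.ListAction using (product)
open import Data.Nat.ListAction.Properties using (product-++)
open import Data.Nat.Properties
open import Data.Nat.Tactic.RingSolver using (solve-∀)
open import Data.Product using (_×_; _,_; Σ-syntax; ∃-syntax; proj₁; proj₂; map₂)
import Data.Rational.Unnormalised as ℚᵘ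
open import Data.Rational.Unnormalised using () renaming (_≥_ to _≥ℚ_)
open import Data.Sum using (_⊎_; inj₁; inj₂; [_,_]′; map)
open import Data.Vec.Base using ([]; _∷_; there; tabulate)
open import Data.Vec.Properties using (lookup⇒[]=; []=⇒lookup; lookup∘tabulate)
open import Function.Base using (_∘_)
open import Induction.WellFounded using (Acc; acc)
open import Relation.Binary.Definitions using (tri<; tri≈; tri>)
open import Relation.Binary.PropositionalEquality using (_≡_; _≢_; refl; sym; trans; cong; cong₂; subst; subst₂)
open import Relation.Nullary using (¬_; yes; no; does; contradiction; _×-dec_)
open import Relation.Nullary.Decidable using (dec-true)
open import Relation.Unary using (Pred; Decidable)
open import Defs

-- Finite subsets

module _ {N : ℕ} where

  ⟦_⟧ : ∀ {ℓ} {P : Pred (Fin N) ℓ} → Decidable P → Subset N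
  ⟦ P? ⟧ = tabulate (does ∘ P?)

  ∈⟦⟧⁺ : ∀ {ℓ} {P : Pred (Fin N) ℓ} (P? : Decidable P) {x} → P x → x ∈ ⟦ P? ⟧
  ∈⟦⟧⁺ P? {x} px =
    lookup⇒[]= x _ (trans (lookup∘tabulate (does ∘ P?) x) (dec-true (P? x) px))

  ∈⟦⟧⁻ : ∀ {ℓ} {P : Pred (Fin N) ℓ} (P? : Decidable P) {x} → x ∈ ⟦ P? ⟧ → P x
  ∈⟦⟧⁻ P? {x} x∈ with P? x | trans (sym (lookup∘tabulate (does ∘ P?) x)) ([]=⇒lookup x∈)
  ... | yes px | _ = px

x∈p─q⇒x∉q : ∀ {N} {x : Fin N} (p q : Subset N) → x ∈ p ─ q → x ∉ q
x∈p─q⇒x∉q (_ ∷ p) (true  ∷ q) (there x∈) (there x∈q) = x∈p─q⇒x∉q p q x∈ x∈q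
x∈p─q⇒x∉q (_ ∷ p) (false ∷ q) (there x∈) (there x∈q) = x∈p─q⇒x∉q p q x∈ x∈q

∣p∪q∣+∣p∩q∣≡∣p∣+∣q∣ : ∀ {N} (p q : Subset N) → ∣ p ∪ q ∣ + ∣ p ∩ q ∣ ≡ ∣ p ∣ + ∣ q ∣
∣p∪q∣+∣p∩q∣≡∣p∣+∣q∣ []          []          = refl
∣p∪q∣+∣p∩q∣≡∣p∣+∣q∣ (false ∷ p) (false ∷ q) = ∣p∪q∣+∣p∩q∣≡∣p∣+∣q∣ p q
∣p∪q∣+∣p∩q∣≡∣p∣+∣q∣ (true ∷ p)  (false ∷ q) = cong suc (∣p∪q∣+∣p∩q∣≡∣p∣+∣q∣ p q)
∣p∪q∣+∣p∩q∣≡∣p∣+∣q∣ (false ∷ p) (true ∷ q)  =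
  trans (cong suc (∣p∪q∣+∣p∩q∣≡∣p∣+∣q∣ p q)) (sym (+-suc ∣ p ∣ ∣ q ∣))
∣p∪q∣+∣p∩q∣≡∣p∣+∣q∣ (true ∷ p)  (true ∷ q)  = cong suc (trans (+-suc _ _)
  (trans (cong suc (∣p∪q∣+∣p∩q∣≡∣p∣+∣q∣ p q)) (sym (+-suc ∣ p ∣ ∣ q ∣))))

∣p∪q∣≤∣p∣+∣q∣ : ∀ {N} (p q : Subset N) → ∣ p ∪ q ∣ ≤ ∣ p ∣ + ∣ q ∣
∣p∪q∣≤∣p∣+∣q∣ p q = ≤-trans (m≤m+n _ _) (≤-reflexive (∣p∪q∣+∣p∩q∣≡∣p∣+∣q∣ p q))

disjoint⇒∣p∪q∣≡∣p∣+∣q∣ : ∀ {N} (p q : Subset N) → (∀ {x} → x ∈ p → x ∉ q) →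
                          ∣ p ∪ q ∣ ≡ ∣ p ∣ + ∣ q ∣
disjoint⇒∣p∪q∣≡∣p∣+∣q∣ {N} p q disj = trans (sym (+-identityʳ _))
  (trans (cong (_+_ ∣ p ∪ q ∣) (sym ∣p∩q∣≡0)) (∣p∪q∣+∣p∩q∣≡∣p∣+∣q∣ p q))
  where
  p∩q-empty : Empty (p ∩ q)
  p∩q-empty (x , x∈) with x∈p∩q⁻ p q x∈
  ... | x∈p , x∈q = disj x∈p x∈q
  ∣p∩q∣≡0 : ∣ p ∩ q ∣ ≡ 0
  ∣p∩q∣≡0 = trans (cong ∣_∣ (Empty-unique p∩q-empty)) (∣⊥∣≡0 N)

∣p∣≤∣q∣+∣p─q∣ : ∀ {N} (p q : Subset N) → ∣ p ∣ ≤ ∣ q ∣ + ∣ p ─ q ∣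
∣p∣≤∣q∣+∣p─q∣ p q = ≤-trans (p⊆q⇒∣p∣≤∣q∣ cover) (∣p∪q∣≤∣p∣+∣q∣ q (p ─ q))
  where
  cover : p ⊆ q ∪ (p ─ q)
  cover {x} x∈p with x ∈? q
  ... | yes x∈q = x∈p∪q⁺ (inj₁ x∈q)
  ... | no  x∉q = x∈p∪q⁺ (inj₂ (x∈p∧x∉q⇒x∈p─q x∈p x∉q))

q⊆p⇒∣p─q∣+∣q∣≤∣p∣ : ∀ {N} (p q : Subset N) → q ⊆ p → ∣ p ─ q ∣ + ∣ q ∣ ≤ ∣ p ∣
q⊆p⇒∣p─q∣+∣q∣≤∣p∣ p q q⊆p = subst (_≤ ∣ p ∣)
  (disjoint⇒∣p∪q∣≡∣p∣+∣q∣ (p ─ q) q (x∈p─q⇒x∉q p q))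
  (p⊆q⇒∣p∣≤∣q∣ ([ p─q⊆p p q , q⊆p ]′ ∘ x∈p∪q⁻ (p ─ q) q))

0<x*y⇒0<y : ∀ x {y} → 0 < x * y → 0 < y
0<x*y⇒0<y x {zero}  0<x*0 = contradiction (subst (0 <_) (*-zeroʳ x) 0<x*0) λ ()
0<x*y⇒0<y x {suc y} _     = z<s

-- Odd closed walks

module _ (G : Graph) where
  open Graph G

  -- Indexing by `ℕ` makes subwalks plain index shifts; values of `vertex` beyond `L` carry no
  -- meaning.
  record ClosedWalk (L : ℕ) : Set where
    field
      vertex : ℕ → Vertex
      step   : ∀ {t} → t < L → Adj (vertex t) (vertex (suc t))
      closed : vertex L ≡ vertex 0

  open ClosedWalk

  -- The visits at times `i` and `i + d` coincide. The `d` steps between them form this closed walk,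
  -- and the remaining `e` steps form `shortcut`.
  excursion : ∀ {L} i d e (W : ClosedWalk L) → i < e → e + d ≡ L →
              vertex W i ≡ vertex W (i + d) → ClosedWalk d
  excursion i d e W i<e refl eq = record
    { vertex = λ t → vertex W (i + t)
    ; step   = λ {t} t<d → subst (Adj (vertex W (i + t)) ∘ vertex W) (sym (+-suc i t))
                 (step W (+-mono-< i<e t<d))
    ; closed = trans (sym eq) (cong (vertex W) (sym (+-identityʳ i)))
    }

  shortcut : ∀ {L} i d e (W : ClosedWalk L) → i < e → e + d ≡ L →
             vertex W i ≡ vertex W (i + d) → ClosedWalk e
  shortcut i d e W i<e refl eq = record { vertex = w ; step = w-step ; closed = w-closed }
    where
    w : ℕ → Vertex
    w t with t ≤? i
    ... | yes _ = vertex W t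
    ... | no  _ = vertex W (t + d)

    w-low : ∀ {t} → t ≤ i → w t ≡ vertex W t
    w-low {t} t≤i with t ≤? i
    ... | yes _   = refl
    ... | no  t≰i = contradiction t≤i t≰i

    w-high : ∀ {t} → i ≤ t → w t ≡ vertex W (t + d)
    w-high {t} i≤t with t ≤? i
    -- Only `t = i` is left here, where the two clauses of `w` agree by the repeated vertex.
    ... | yes t≤i rewrite ≤-antisym t≤i i≤t = eq
    ... | no  _   = refl

    w-step : ∀ {t} → t < e → Adj (w t) (w (suc t))
    w-step {t} t<e with <-≤-connex t i
    ... | inj₁ t<i = subst₂ Adj (sym (w-low (<⇒≤ t<i))) (sym (w-low t<i))
                       (step W (≤-trans t<e (m≤m+n e d)))
    ... | inj₂ i≤t = subst₂ Adj (sym (w-high i≤t)) (sym (w-high (m≤n⇒m≤1+n i≤t)))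
                       (step W (+-monoˡ-< d t<e))

    w-closed : w e ≡ w 0
    w-closed = trans (w-high (<⇒≤ i<e)) (trans (closed W) (sym (w-low z≤n)))

  Simple : ∀ {L} → ClosedWalk L → Set
  Simple {L} W = ∀ {i j : Fin L} → vertex W (toℕ i) ≡ vertex W (toℕ j) → i ≡ j

  ShorterOdd : ℕ → Set
  ShorterOdd L = ∃[ L′ ] L′ < L × Odd L′ × ClosedWalk L′

  -- At a repeated vertex a closed walk splits into two shorter ones; one of them is odd.
  split : ∀ {L} i d e (W : ClosedWalk L) → 0 < d → i < e → e + d ≡ L →
          vertex W i ≡ vertex W (i + d) → Odd L → ShorterOdd L
  split i d e W 0<d i<e refl eq odd with 2 ∣? d
  ... | no  2∤d = d , m<n+m d (≤-<-trans z≤n i<e) , 2∤d , excursion i d e W i<e refl eq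
  ... | yes 2∣d = e , m<m+n e 0<d , (λ 2∣e → odd (∣m∣n⇒∣m+n 2∣e 2∣d)) , shortcut i d e W i<e refl eq

  split-at : ∀ {L} (W : ClosedWalk L) {i j} → i < j → j < L → vertex W i ≡ vertex W j →
             Odd L → ShorterOdd L
  split-at {L} W {i} {j} i<j j<L eq = split i d (L ∸ d) W (m<n⇒0<n∸m i<j)
    (m+n≤o⇒m≤o∸n (suc i) (subst (_< L) (sym i+d≡j) j<L))
    (m∸n+n≡m (≤-trans (m∸n≤m j i) (<⇒≤ j<L)))
    (trans eq (cong (vertex W) (sym i+d≡j)))
    where
    d = j ∸ i
    i+d≡j : i + d ≡ j
    i+d≡j = m+[n∸m]≡n (<⇒≤ i<j)

  shorter⊎simple : ∀ {L} (W : ClosedWalk L) → Odd L → ShorterOdd L ⊎ Simple W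
  shorter⊎simple {L} W odd
    with any? (λ (i : Fin L) → any? (λ (j : Fin L) →
           (i Fin.<? j) ×-dec (vertex W (toℕ i) Fin.≟ vertex W (toℕ j))))
  ... | yes (i , j , i<j , eq) = inj₁ (split-at W i<j (toℕ<n j) eq odd)
  ... | no ∄ = inj₂ simple
    where
    simple : Simple W
    simple {i} {j} eq with Fin.<-cmp i j
    ... | tri< i<j _ _ = contradiction (i , j , i<j , eq) ∄
    ... | tri≈ _ i≡j _ = i≡j
    ... | tri> _ _ j<i = contradiction (j , i , j<i , sym eq) ∄

  -- Lengths 0 and 2 are even and length 1 would be a loop, so at least three distinct vertices
  -- remain.
  simple⇒cycle : ∀ {L} (W : ClosedWalk L) → Odd L → Simple W →
    Σ[ C ∈ Cycle G ] Cycle.length C ≡ L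
  simple⇒cycle {0} W odd simple = contradiction (divides 0 refl) odd
  simple⇒cycle {1} W odd simple =
    contradiction (subst (Adj _) (closed W) (step W z<s)) (irrefl _)
  simple⇒cycle {2} W odd simple = contradiction (divides 1 refl) odd
  simple⇒cycle {suc m@(suc (suc _))} W odd simple = record
    { m        = m
    ; 3≤length = s≤s (s≤s (s≤s z≤n))
    ; vertex   = vertex W ∘ toℕ
    ; distinct = simple
    ; step     = λ i → subst (λ t → Adj (vertex W t) (vertex W (suc (toℕ i))))
                   (sym (toℕ-inject₁ i)) (step W (m<n⇒m<1+n (toℕ<n i)))
    ; close    = subst₂ Adj (cong (vertex W) (sym (toℕ-fromℕ m))) (closed W) (step W ≤-refl)
    } , refl

  oddClosedWalk⇒oddCycle : ∀ {L} → Acc _<_ L → ClosedWalk L → Odd L →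
    Σ[ C ∈ Cycle G ] Odd (Cycle.length C) × Cycle.length C ≤ L
  oddClosedWalk⇒oddCycle (acc rec) W odd with shorter⊎simple W odd
  ... | inj₂ simple with simple⇒cycle W odd simple
  ...   | C , refl = C , odd , ≤-refl
  oddClosedWalk⇒oddCycle (acc rec) W odd | inj₁ (_ , L′<L , odd′ , W′)
    with oddClosedWalk⇒oddCycle (rec L′<L) W′ odd′
  ... | C , C-odd , C≤L′ = C , C-odd , ≤-trans C≤L′ (<⇒≤ L′<L)

  -- Walks between two vertices

  infixr 5 _∷_

  data Walk : ℕ → Vertex → Vertex → Set where
    []  : ∀ {u} → Walk 0 u u
    _∷_ : ∀ {n u v w} → Adj u v → Walk n v w → Walk (suc n) u w

  reverse-++ : ∀ {m n u v w} → Walk m u v → Walk n u w → Walk (m + n) v w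
  reverse-++ []              q = q
  reverse-++ {suc m} {n} {_} {v} {w} (e ∷ p) q =
    subst (λ l → Walk l v w) (+-suc m n) (reverse-++ p (symm e ∷ q))

  -- Past its end the walk stays at its last vertex.
  at : ∀ {n u v} → Walk n u v → ℕ → Vertex
  at {u = u} []      t       = u
  at {u = u} (e ∷ p) zero    = u
  at         (e ∷ p) (suc t) = at p t

  at-start : ∀ {n u v} (p : Walk n u v) → at p 0 ≡ u
  at-start []      = refl
  at-start (e ∷ p) = refl

  at-end : ∀ {n u v} (p : Walk n u v) → at p n ≡ v
  at-end []      = refl
  at-end (e ∷ p) = at-end p

  at-step : ∀ {n u v} (p : Walk n u v) {t} → t < n → Adj (at p t) (at p (suc t))
  at-step (e ∷ p) {zero}  _         = subst (Adj _) (sym (at-start p)) e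
  at-step (e ∷ p) {suc t} (s≤s t<n) = at-step p t<n

  closedWalk : ∀ {n u} → Walk n u u → ClosedWalk n
  closedWalk p = record
    { vertex = at p ; step = at-step p ; closed = trans (at-end p) (sym (at-start p)) }

  -- Independent sets

  Independent : Subset order → Set
  Independent A = ∀ {u v} → u ∈ A → v ∈ A → ¬ Adj u v

  neighbour? : ∀ A → Decidable (λ u → ∃[ w ] w ∈ A × Adj w u)
  neighbour? A u = any? (λ w → (w ∈? A) ×-dec adj? w u)

  N[_] : Subset order → Subset order
  N[ A ] = ⟦ neighbour? A ⟧

  -- Walks may backtrack, so layer S v i is the alternating ball of D_i, D_{i-2}, … rather than a
  -- distance sphere.  In exchange the neighbourhood in S of one layer is exactly the next.
  layer : Subset order → Vertex → ℕ → Subset order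
  layer S v zero    = ⁅ v ⁆
  layer S v (suc i) = S ∩ N[ layer S v i ]

  layer⇒walk : ∀ S v i {u} → u ∈ layer S v i → Walk i u v
  layer⇒walk S v zero    u∈ rewrite x∈⁅y⁆⇒x≡y v u∈ = []
  layer⇒walk S v (suc i) u∈ with ∈⟦⟧⁻ (neighbour? (layer S v i)) (proj₂ (x∈p∩q⁻ S _ u∈))
  ... | w , w∈ , w~u = symm w~u ∷ layer⇒walk S v i w∈

  layer⊆ : ∀ {S v} → v ∈ S → ∀ i → layer S v i ⊆ S
  layer⊆ {S} {v} v∈S zero    x∈ rewrite x∈⁅y⁆⇒x≡y v x∈ = v∈S
  layer⊆ {S} {v} v∈S (suc i) x∈ = proj₁ (x∈p∩q⁻ S _ x∈)

  odd-i+[1+i] : ∀ i → Odd (i + suc i)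
  odd-i+[1+i] i 2∣ = contradiction (∣1⇒≡1 (∣m+n∣m⇒∣n (subst (2 ∣_) (lemma i) 2∣) (m∣m*n i))) λ ()
    where
    lemma : ∀ i → i + suc i ≡ 2 * i + 1
    lemma = solve-∀

  -- Two walks of length `i` to `v` and an edge between their starting points make a closed walk of
  -- length `2 * i + 1`. Here `k` is one less than the parameter of the theorem, so this is at most
  -- `2 * suc k ∸ 1`.
  layer-independent : ∀ k → NoOddCycleUpTo (2 * suc k ∸ 1) G →
                      ∀ S v i → i ≤ k → Independent (layer S v i)
  layer-independent k noOdd S v i i≤k x∈ y∈ x~y
    with oddClosedWalk⇒oddCycle (<-wellFounded _)
           (closedWalk (reverse-++ (layer⇒walk S v i y∈) (symm x~y ∷ layer⇒walk S v i x∈)))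
           (odd-i+[1+i] i)
  ... | C , C-odd , C≤ = noOdd C C-odd (≤-trans C≤
        (+-mono-≤ i≤k (s≤s (≤-trans i≤k (m≤m+n k 0)))))

  -- Growth of layers, with ρ = a / b

  module _ (a b : ℕ) where

    -- The lower bound on the layer makes it nonempty when `a` is positive, so that deleting it
    -- shrinks `S`.
    SlowLayer : Subset order → Vertex → ℕ → Set
    SlowLayer S v j = ∃[ i ] i < j × a ^ i ≤ b ^ i * ∣ layer S v i ∣ ×
                             b * ∣ layer S v (suc i) ∣ ≤ a * ∣ layer S v i ∣

    slow⊎large : ∀ S v j → SlowLayer S v j ⊎ a ^ j ≤ b ^ j * ∣ layer S v j ∣
    slow⊎large S v zero = inj₂ (≤-reflexive (sym (trans (*-identityˡ _) (∣⁅x⁆∣≡1 v))))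
    slow⊎large S v (suc j) with slow⊎large S v j
    ... | inj₁ (i , i<j , slow) = inj₁ (i , m<n⇒m<1+n i<j , slow)
    ... | inj₂ large with b * ∣ layer S v (suc j) ∣ ≤? a * ∣ layer S v j ∣
    ...   | yes slow = inj₁ (j , ≤-refl , large , slow)
    ...   | no  fast = inj₂ (begin
      a * a ^ j                                ≤⟨ *-monoʳ-≤ a large ⟩
      a * (b ^ j * ∣ layer S v j ∣)            ≡⟨ x*[y*z]≡y*[x*z] a (b ^ j) _ ⟩
      b ^ j * (a * ∣ layer S v j ∣)            ≤⟨ *-monoʳ-≤ (b ^ j) (<⇒≤ (≰⇒> fast)) ⟩
      b ^ j * (b * ∣ layer S v (suc j) ∣)      ≡⟨ x*[y*z]≡y*x*z (b ^ j) b _ ⟩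
      b * b ^ j * ∣ layer S v (suc j) ∣        ∎)
      where
      open ≤-Reasoning
      x*[y*z]≡y*[x*z] : ∀ x y z → x * (y * z) ≡ y * (x * z)
      x*[y*z]≡y*[x*z] = solve-∀
      x*[y*z]≡y*x*z : ∀ x y z → x * (y * z) ≡ y * x * z
      x*[y*z]≡y*x*z = solve-∀

    LargeIndependent : ℕ → Subset order → Set
    LargeIndependent k S = ∃[ A ] A ⊆ S × Independent A × a ^ k ≤ b ^ k * ∣ A ∣

    DenseIndependent : Subset order → Set
    DenseIndependent S = ∃[ I ] I ⊆ S × Independent I × b * ∣ S ∣ ≤ (a + b) * ∣ I ∣

    module _ (k : ℕ) (0<a : 0 < a)
             (independent : ∀ S v i → i ≤ k → Independent (layer S v i)) where

      -- Deleting the neighbours of `A` leaves no edge from `A` to `I`. Slowness says that `A` has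
      -- density at least b / (a + b) in the deleted part, and `I` has this density in the rest.
      dense-∪ : ∀ S A → A ⊆ S → Independent A → b * ∣ S ∩ N[ A ] ∣ ≤ a * ∣ A ∣ →
                DenseIndependent ((S ─ A) ─ (S ∩ N[ A ])) → DenseIndependent S
      dense-∪ S A A⊆S A-ind slow (I , I⊆T , I-ind , dense) =
        A ∪ I , A∪I⊆S , A∪I-ind , (begin
          b * ∣ S ∣                             ≤⟨ *-monoʳ-≤ b ∣S∣≤ ⟩
          b * (∣ A ∣ + (∣ B ∣ + ∣ T ∣))         ≡⟨ expand b (∣ A ∣) (∣ B ∣) (∣ T ∣) ⟩
          b * ∣ B ∣ + (b * ∣ T ∣ + b * ∣ A ∣)   ≤⟨ +-mono-≤ slow (+-monoˡ-≤ _ dense) ⟩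
          a * ∣ A ∣ + ((a + b) * ∣ I ∣ + b * ∣ A ∣)
                                                ≡⟨ collect a b (∣ A ∣) (∣ I ∣) ⟩
          (a + b) * (∣ A ∣ + ∣ I ∣)             ≡⟨ cong ((a + b) *_) (sym ∣A∪I∣) ⟩
          (a + b) * ∣ A ∪ I ∣                   ∎)
        where
        open ≤-Reasoning
        B = S ∩ N[ A ]
        T = (S ─ A) ─ B
        expand : ∀ b x y z → b * (x + (y + z)) ≡ b * y + (b * z + b * x)
        expand = solve-∀
        collect : ∀ a b x y → a * x + ((a + b) * y + b * x) ≡ (a + b) * (x + y)
        collect = solve-∀
        ∣S∣≤ : ∣ S ∣ ≤ ∣ A ∣ + (∣ B ∣ + ∣ T ∣)
        ∣S∣≤ = ≤-trans (∣p∣≤∣q∣+∣p─q∣ S A) (+-monoʳ-≤ (∣ A ∣) (∣p∣≤∣q∣+∣p─q∣ (S ─ A) B))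
        I⊆S─A : I ⊆ S ─ A
        I⊆S─A = p─q⊆p (S ─ A) B ∘ I⊆T
        I⊆S : I ⊆ S
        I⊆S = p─q⊆p S A ∘ I⊆S─A
        ∣A∪I∣ : ∣ A ∪ I ∣ ≡ ∣ A ∣ + ∣ I ∣
        ∣A∪I∣ = disjoint⇒∣p∪q∣≡∣p∣+∣q∣ A I (λ x∈A x∈I → x∈p─q⇒x∉q S A (I⊆S─A x∈I) x∈A)
        A∪I⊆S : A ∪ I ⊆ S
        A∪I⊆S = [ A⊆S , I⊆S ]′ ∘ x∈p∪q⁻ A I
        nonadjacent : ∀ {u v} → u ∈ A → v ∈ I → ¬ Adj u v
        nonadjacent u∈A v∈I u~v = x∈p─q⇒x∉q (S ─ A) B (I⊆T v∈I)
          (x∈p∩q⁺ (I⊆S v∈I , ∈⟦⟧⁺ (neighbour? A) (_ , u∈A , u~v)))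
        A∪I-ind : Independent (A ∪ I)
        A∪I-ind u∈ v∈ u~v with x∈p∪q⁻ A I u∈ | x∈p∪q⁻ A I v∈
        ... | inj₁ u∈A | inj₁ v∈A = A-ind u∈A v∈A u~v
        ... | inj₁ u∈A | inj₂ v∈I = nonadjacent u∈A v∈I u~v
        ... | inj₂ u∈I | inj₁ v∈A = nonadjacent v∈A u∈I (symm u~v)
        ... | inj₂ u∈I | inj₂ v∈I = I-ind u∈I v∈I u~v

      -- Repeatedly remove from S a slow layer A together with its neighbours: the removed layers
      -- form an independent set I of density at least b / (a + b).
      large⊎dense : ∀ S → Acc _<_ (∣ S ∣) → LargeIndependent k S ⊎ DenseIndependent S
      large⊎dense S (acc rec) with nonempty? S
      ... | no S-empty =
        inj₂ (S , (λ x∈ → x∈) , (λ u∈S _ _ → S-empty (_ , u∈S)) , *-monoˡ-≤ (∣ S ∣) (m≤n+m b a))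
      ... | yes (v , v∈S) with slow⊎large S v k
      ...   | inj₂ large = inj₁ (layer S v k , layer⊆ v∈S k , independent S v k ≤-refl , large)
      ...   | inj₁ (i , i<k , positive , slow) =
        -- A large set found in the remainder serves for `S` unchanged; a dense one is joined with
        -- `A`.
        map (λ (I , I⊆T , rest) → I , p─q⊆p S A ∘ p─q⊆p (S ─ A) B ∘ I⊆T , rest)
            (dense-∪ S A (layer⊆ v∈S i) (independent S v i (<⇒≤ i<k)) slow)
            (large⊎dense ((S ─ A) ─ B) (rec shrinks))
        where
        A = layer S v i
        B = layer S v (suc i)
        0<∣A∣ : 0 < ∣ A ∣
        0<∣A∣ = 0<x*y⇒0<y (b ^ i) (≤-trans (m^n>0 a {{>-nonZero 0<a}} i) positive)
        shrinks : ∣ (S ─ A) ─ B ∣ < ∣ S ∣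
        shrinks = ≤-<-trans (∣p─q∣≤∣p∣ (S ─ A) B)
          (<-≤-trans (m<m+n _ 0<∣A∣) (q⊆p⇒∣p─q∣+∣q∣≤∣p∣ S A (layer⊆ v∈S i)))

  -- Colourings of induced subgraphs

  ColourableOn : ℕ → Subset order → Set
  ColourableOn n S =
    Σ[ colour ∈ (Vertex → Fin n) ] (∀ {u v} → u ∈ S → v ∈ S → Adj u v → colour u ≢ colour v)

  colourable-extend : ∀ {n S I} → Independent I → ColourableOn n (S ─ I) → ColourableOn (suc n) S
  colourable-extend {n} {S} {I} I-ind (colour , proper) = colour′ , proper′
    where
    colour′ : Vertex → Fin (suc n)
    colour′ u with u ∈? I
    ... | yes _ = zero
    ... | no  _ = suc (colour u)
    proper′ : ∀ {u v} → u ∈ S → v ∈ S → Adj u v → colour′ u ≢ colour′ v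
    proper′ {u} {v} u∈S v∈S u~v with u ∈? I | v ∈? I
    ... | yes u∈I | yes v∈I = λ _ → I-ind u∈I v∈I u~v
    ... | yes _   | no  _   = λ ()
    ... | no  _   | yes _   = λ ()
    ... | no  u∉I | no  v∉I =
      proper (x∈p∧x∉q⇒x∈p─q u∈S u∉I) (x∈p∧x∉q⇒x∈p─q v∈S v∉I) u~v ∘ Fin.suc-injective

  adj⇒≢ : ∀ {u v} → Adj u v → u ≢ v
  adj⇒≢ u~v refl = irrefl _ u~v

  four-distinct : ∀ {S : Subset order} {u v x y} → u ∈ S → v ∈ S → x ∈ S → y ∈ S →
                  u ≢ v → u ≢ x → u ≢ y → v ≢ x → v ≢ y → x ≢ y → 4 ≤ ∣ S ∣
  four-distinct u∈ v∈ x∈ y∈ u≢v u≢x u≢y v≢x v≢y x≢y =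
    <-≤-trans (s≤s (<-≤-trans (s≤s (<-≤-trans (s≤s (<-≤-trans z<s
      (x∈p⇒∣p-x∣<∣p∣ y∈₃))) (x∈p⇒∣p-x∣<∣p∣ x∈₂))) (x∈p⇒∣p-x∣<∣p∣ v∈₁))) (x∈p⇒∣p-x∣<∣p∣ u∈)
    where
    v∈₁ = x∈p∧x≢y⇒x∈p-y v∈ (u≢v ∘ sym)
    x∈₂ = x∈p∧x≢y⇒x∈p-y (x∈p∧x≢y⇒x∈p-y x∈ (u≢x ∘ sym)) (v≢x ∘ sym)
    y∈₃ = x∈p∧x≢y⇒x∈p-y (x∈p∧x≢y⇒x∈p-y (x∈p∧x≢y⇒x∈p-y y∈ (u≢y ∘ sym)) (v≢y ∘ sym)) (x≢y ∘ sym)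

  -- Given an edge u ~ v of S, the neighbours of u get one colour and all other vertices the other.
  triangleFree⇒2-colourable : (∀ {u v w} → Adj u v → Adj u w → ¬ Adj v w) →
                              ∀ S → ∣ S ∣ < 4 → ColourableOn 2 S
  triangleFree⇒2-colourable no-triangle S ∣S∣<4
    with any? (λ u → any? (λ v → (u ∈? S) ×-dec ((v ∈? S) ×-dec adj? u v)))
  ... | no ∄ = (λ _ → zero) , λ u∈ v∈ u~v _ → ∄ (_ , _ , u∈ , v∈ , u~v)
  ... | yes (u , v , u∈ , v∈ , u~v) = colour , proper
    where
    colour : Vertex → Fin 2
    colour x with adj? u x
    ... | yes _ = zero
    ... | no  _ = suc zero
    proper : ∀ {x y} → x ∈ S → y ∈ S → Adj x y → colour x ≢ colour y
    proper {x} {y} x∈ y∈ x~y with adj? u x | adj? u y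
    ... | yes u~x | yes u~y = λ _ → no-triangle u~x u~y x~y
    ... | yes _   | no  _   = λ ()
    ... | no  _   | yes _   = λ ()
    -- If neither `x` nor `y` is adjacent to `u`, the edges `u ~ v` and `x ~ y` have no common
    -- endpoint, which takes four vertices.
    ... | no  u≁x | no  u≁y = λ _ → <⇒≱ ∣S∣<4 (four-distinct u∈ v∈ x∈ y∈
      (adj⇒≢ u~v) (λ { refl → u≁y x~y }) (λ { refl → u≁x (symm x~y) })
      (λ { refl → u≁x u~v }) (λ { refl → u≁y u~v }) (adj⇒≢ x~y))

  -- With this, independence of the first layer around `u` excludes triangles through `u`.
  layer₁⁺ : ∀ {u v} → Adj u v → v ∈ layer ⊤ u 1
  layer₁⁺ {u} u~v = x∈p∩q⁺ (∈⊤ , ∈⟦⟧⁺ (neighbour? ⁅ u ⁆) (u , x∈⁅x⁆ u , u~v))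

-- The bound

numerator : ℕ → ℕ → ℕ
numerator n k = product (applyUpTo (λ i → n + k + i) k)

product-applyUpTo-∷ʳ : ∀ f m → product (applyUpTo f (suc m)) ≡ product (applyUpTo f m) * f m
product-applyUpTo-∷ʳ f m = trans (cong product (sym (applyUpTo-∷ʳ f m)))
  (trans (product-++ (applyUpTo f m) [ f m ]) (cong (product (applyUpTo f m) *_) (*-identityʳ (f m))))

product-applyUpTo-cong : ∀ {f g} → (∀ i → f i ≡ g i) → ∀ m →
                         product (applyUpTo f m) ≡ product (applyUpTo g m)
product-applyUpTo-cong f≗g zero    = refl
product-applyUpTo-cong f≗g (suc m) = cong₂ _*_ (f≗g 0) (product-applyUpTo-cong (f≗g ∘ suc) m)

product-applyUpTo-≤ : ∀ f c m → (∀ {i} → i < m → f i ≤ c) → product (applyUpTo f m) ≤ c ^ m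
product-applyUpTo-≤ f c zero    f≤c = ≤-refl
product-applyUpTo-≤ f c (suc m) f≤c =
  *-mono-≤ (f≤c z<s) (product-applyUpTo-≤ (f ∘ suc) c m (f≤c ∘ s≤s))

-- The factors common to the numerators for n and for n + 1, where k = k′ + 1.
common : ℕ → ℕ → ℕ
common n k′ = product (applyUpTo (λ i → suc (n + suc k′) + i) k′)

numerator-common : ∀ n k′ → numerator n (suc k′) ≡ (n + suc k′) * common n k′
numerator-common n k′ = cong₂ _*_ (+-identityʳ (n + suc k′)) (product-applyUpTo-cong (+-suc (n + suc k′)) k′)

numerator-suc-common : ∀ n k′ → numerator (suc n) (suc k′) ≡ common n k′ * (n + suc k′ + suc k′)
numerator-suc-common n k′ = trans (product-applyUpTo-∷ʳ (λ i → suc (n + suc k′) + i) k′)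
  (cong (common n k′ *_) (sym (+-suc (n + suc k′) k′)))

[m*n]^o≡m^o*n^o : ∀ m n o → (m * n) ^ o ≡ m ^ o * n ^ o
[m*n]^o≡m^o*n^o m n zero    = refl
[m*n]^o≡m^o*n^o m n (suc o) =
  trans (cong (m * n *_) ([m*n]^o≡m^o*n^o m n o)) (interchange m n (m ^ o) (n ^ o))
  where
  interchange : ∀ w x y z → w * x * (y * z) ≡ w * y * (x * z)
  interchange = solve-∀

-- Each of the `k′` factors is at most twice `n + suc k′`. Divided by the denominator, this bounds
-- the increment of B from `n` to `n + 1` by ρ ^ k′ with ρ = (n + k) / k.
common≤ : ∀ n k′ → common n k′ ≤ 2 ^ k′ * (n + suc k′) ^ k′
common≤ n k′ = ≤-trans
  (product-applyUpTo-≤ _ (2 * (n + suc k′)) k′ bounded)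
  (≤-reflexive ([m*n]^o≡m^o*n^o 2 (n + suc k′) k′))
  where
  bounded : ∀ {i} → i < k′ → suc (n + suc k′) + i ≤ 2 * (n + suc k′)
  bounded {i} i<k′ = ≤-trans (≤-reflexive (sym (+-suc (n + suc k′) i)))
    (+-monoʳ-≤ (n + suc k′) (≤-trans i<k′ (≤-trans (n≤1+n k′) (≤-trans (m≤n+m _ n) (m≤m+n _ 0)))))

-- All factors but the last are at most `2 * k`, and the last is 2k + 1 ≤ 3k.
numerator-2≤ : ∀ k′ → numerator 2 (suc k′) ≤ 3 * denominator (suc k′)
numerator-2≤ k′ = begin
  numerator 2 k                              ≡⟨ product-applyUpTo-∷ʳ (λ i → 2 + k + i) k′ ⟩
  product (applyUpTo _ k′) * (2 + k + k′)    ≤⟨ *-mono-≤ (product-applyUpTo-≤ _ (2 * k) k′ bounded) last ⟩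
  (2 * k) ^ k′ * (3 * k)                     ≡⟨ cong (_* (3 * k)) ([m*n]^o≡m^o*n^o 2 k k′) ⟩
  2 ^ k′ * k ^ k′ * (3 * k)                  ≡⟨ rearrange (2 ^ k′) (k ^ k′) k ⟩
  3 * (2 ^ k′ * (k * k ^ k′))                ∎
  where
  open ≤-Reasoning
  k = suc k′
  rearrange : ∀ x y z → x * y * (3 * z) ≡ 3 * (x * (z * y))
  rearrange = solve-∀
  bounded : ∀ {i} → i < k′ → 2 + k + i ≤ 2 * k
  bounded {i} i<k′ = begin
    2 + k + i     ≡⟨ shift k i ⟩
    k + (2 + i)   ≤⟨ +-monoʳ-≤ k (≤-trans (s≤s i<k′) (m≤m+n k 0)) ⟩
    2 * k         ∎
    where
    shift : ∀ x y → 2 + x + y ≡ x + (2 + y)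
    shift = solve-∀
  last : 2 + k + k′ ≤ 3 * k
  last = ≤-trans (m≤m+n (2 + k + k′) k′) (≤-reflexive (sum k′))
    where
    sum : ∀ x → 2 + suc x + x + x ≡ 3 * suc x
    sum = solve-∀

-- Here D is the denominator, q the common part of the numerators, so that q (a + b) and a q are
-- the numerators for n + 1 and n; s, i, x are the sizes of S, of the removed set and of the rest.
large-drop : ∀ {D q a b x i s} → D * s < q * (a + b) + D → x + i ≤ s → b * q ≤ D * i →
             D * x < a * q + D
large-drop {D} {q} {a} {b} {x} {i} {s} small x+i≤s large =
  +-cancelʳ-< (b * q) _ _ (begin-strict
    D * x + b * q          ≤⟨ +-monoʳ-≤ (D * x) large ⟩
    D * x + D * i          ≡⟨ sym (*-distribˡ-+ D x i) ⟩
    D * (x + i)            ≤⟨ *-monoʳ-≤ D x+i≤s ⟩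
    D * s                  <⟨ small ⟩
    q * (a + b) + D        ≡⟨ rearrange q a b D ⟩
    a * q + D + b * q      ∎)
  where
  open ≤-Reasoning
  rearrange : ∀ q a b D → q * (a + b) + D ≡ a * q + D + b * q
  rearrange = solve-∀

dense-drop : ∀ {D q a b x i s} → 0 < a → D * s < q * (a + b) + D → x + i ≤ s →
             b * s ≤ (a + b) * i → D * x < a * q + D
dense-drop {D} {q} {a} {b} {x} {i} {s} 0<a small x+i≤s dense =
  *-cancelˡ-< (a + b) _ _ (begin-strict
    (a + b) * (D * x)           ≡⟨ swap (a + b) D x ⟩
    D * ((a + b) * x)           ≤⟨ *-monoʳ-≤ D share ⟩
    D * (a * s)                 ≡⟨ swap D a s ⟩
    a * (D * s)                 <⟨ *-monoʳ-< a {{>-nonZero 0<a}} small ⟩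
    -- The summand `D` has been scaled by `a` only; adding `b * D` lets the factor `a + b` be taken
    -- out.
    a * (q * (a + b) + D)       ≤⟨ m≤m+n _ (b * D) ⟩
    a * (q * (a + b) + D) + b * D
                                ≡⟨ collect q a b D ⟩
    (a + b) * (a * q + D)       ∎)
  where
  open ≤-Reasoning
  swap : ∀ x y z → x * (y * z) ≡ y * (x * z)
  swap = solve-∀
  collect : ∀ q a b D → a * (q * (a + b) + D) + b * D ≡ (a + b) * (a * q + D)
  collect = solve-∀
  distribute : ∀ a b x i → (a + b) * x + (a + b) * i ≡ a * (x + i) + b * (x + i)
  distribute = solve-∀
  share : (a + b) * x ≤ a * s
  share = +-cancelʳ-≤ ((a + b) * i) _ _ (begin
    (a + b) * x + (a + b) * i   ≡⟨ distribute a b x i ⟩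
    a * (x + i) + b * (x + i)   ≤⟨ +-mono-≤ (*-monoʳ-≤ a x+i≤s) (*-monoʳ-≤ b x+i≤s) ⟩
    a * s + b * s               ≤⟨ +-monoʳ-≤ (a * s) dense ⟩
    a * s + (a + b) * i         ∎)

-- Induction on the number of colours

module _ (G : Graph) (k′ : ℕ) (noOdd : NoOddCycleUpTo (2 * suc k′ ∸ 1) G) where
  open Graph G

  private
    k = suc k′
    D = denominator k

  -- The hypothesis is |S| < B + 1 with denominators cleared. The extra 1 lets the maximality
  -- argument treat `f + 1` vertices when f < B.
  small⇒colourableOn : 1 ≤ k′ → ∀ n S → D * ∣ S ∣ < numerator (2 + n) k + D →
                       ColourableOn G (2 + n) S
  small⇒colourableOn 1≤k′ zero S small = triangleFree⇒2-colourable G no-triangle S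
    (*-cancelˡ-< D _ _ (<-≤-trans small (≤-trans (+-monoˡ-≤ D (numerator-2≤ k′))
      (≤-reflexive (3D+D≡D4 D)))))
    where
    3D+D≡D4 : ∀ D → 3 * D + D ≡ D * 4
    3D+D≡D4 = solve-∀
    no-triangle : ∀ {u v w} → Adj u v → Adj u w → ¬ Adj v w
    no-triangle {u} u~v u~w =
      layer-independent G k′ noOdd ⊤ u 1 1≤k′ (layer₁⁺ G u~v) (layer₁⁺ G u~w)
  small⇒colourableOn 1≤k′ (suc n) S small =
    [ (λ (A , A⊆S , A-ind , large) → colour-with A-ind
        (large-drop {q = q} {a} small′ (q⊆p⇒∣p─q∣+∣q∣≤∣p∣ S A A⊆S) (kq≤D∣A∣ A large)))
    , (λ (I , I⊆S , I-ind , dense) → colour-with I-ind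
        (dense-drop {q = q} {a} z<s small′ (q⊆p⇒∣p─q∣+∣q∣≤∣p∣ S I I⊆S) dense))
    ]′ (large⊎dense G a k k′ z<s (layer-independent G k′ noOdd) S (<-wellFounded _))
    where
    open ≤-Reasoning
    -- Passing from `3 + n` to `2 + n` colours, ρ is `a` over `k`, and `a` is the first factor of
    -- the smaller numerator.
    a = 2 + n + k
    q = common (2 + n) k′
    small′ : D * ∣ S ∣ < q * (a + k) + D
    small′ = subst (λ m → D * ∣ S ∣ < m + D) (numerator-suc-common (2 + n) k′) small
    colour-with : ∀ {I} → Independent G I → D * ∣ S ─ I ∣ < a * q + D → ColourableOn G (3 + n) S
    colour-with {I} I-ind small″ = colourable-extend G I-ind (small⇒colourableOn 1≤k′ n (S ─ I)
      (subst (λ m → D * ∣ S ─ I ∣ < m + D) (sym (numerator-common (2 + n) k′)) small″))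
    rearrange : ∀ x y z w → x * (y * (z * w)) ≡ y * (x * z) * w
    rearrange = solve-∀
    kq≤D∣A∣ : ∀ A → a ^ k′ ≤ k ^ k′ * ∣ A ∣ → k * q ≤ D * ∣ A ∣
    kq≤D∣A∣ A large = begin
      k * q                             ≤⟨ *-monoʳ-≤ k (common≤ (2 + n) k′) ⟩
      k * (2 ^ k′ * a ^ k′)             ≤⟨ *-monoʳ-≤ k (*-monoʳ-≤ (2 ^ k′) large) ⟩
      k * (2 ^ k′ * (k ^ k′ * ∣ A ∣))   ≡⟨ rearrange k (2 ^ k′) (k ^ k′) (∣ A ∣) ⟩
      D * ∣ A ∣                         ∎

-- From colourability to the rational bound

p≤m*d⇒p/d≤m/1 : ∀ p m d .{{_ : NonZero d}} → p ≤ m * d → (+ p) ℚᵘ./ d ℚᵘ.≤ fromℕ-ℚᵘ m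
p≤m*d⇒p/d≤m/1 p m d@(suc _) p≤m*d = ℚᵘ.*≤* (subst₂ ℤ._≤_
  (sym (ℤ.*-identityʳ (+ p))) (ℤ.pos-* m d) (+≤+ p≤m*d))

-- If f < B then f + 1 < B + 1, so `suc f` still has the colouring property; hence a maximal `f`
-- cannot lie below B.
below⇒colourableUpTo : ∀ k n f → 2 ≤ k → 2 ≤ n → f * denominator k < numerator n k →
                       ColourableUpTo n k (suc f)
below⇒colourableUpTo (suc k′) (suc (suc n)) f (s≤s 1≤k′) (s≤s (s≤s _)) below G noOdd order≤ =
  map₂ (λ proper → proper ∈⊤ ∈⊤) (small⇒colourableOn G k′ noOdd 1≤k′ n ⊤ small)
  where
  open ≤-Reasoning
  D = denominator (suc k′)
  small : D * ∣ ⊤ {Graph.order G} ∣ < numerator (2 + n) (suc k′) + D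
  small = begin-strict
    D * ∣ ⊤ {Graph.order G} ∣          ≡⟨ cong (D *_) (∣⊤∣≡n _) ⟩
    D * Graph.order G                  ≤⟨ *-monoʳ-≤ D order≤ ⟩
    D * suc f                          ≡⟨ *-comm D (suc f) ⟩
    D + f * D                          ≡⟨ +-comm D (f * D) ⟩
    f * D + D                          <⟨ +-monoˡ-< D below ⟩
    numerator (2 + n) (suc k′) + D     ∎

theorem3 : ∀ (k n : ℕ) → 2 ≤ k → 2 ≤ n →
    ∀ (f : ℕ) → Is-f⟨ n , k ⟩ f → fromℕ-ℚᵘ f ≥ℚ bound n k
theorem3 k n 2≤k 2≤n f (_ , maximal) =
  p≤m*d⇒p/d≤m/1 (numerator n k) f (denominator k) {{denominator≢0 k}}
    (≮⇒≥ λ below → <⇒≱ ≤-refl (maximal (suc f) (below⇒colourableUpTo k n f 2≤k 2≤n below)))
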